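{- Let $G$ be a finitary clone on a finite set $A$. Then the finitary centralizer $G^{\perp(\aleph_0)}$ is the set of all finitary operations $f:A^n \rightarrow A$ $(n \in \aleph_0)$ such that $h(f) = f\bigl(\bigl(h(\pi_i)\bigr)_{i \in n}\bigr)$ for every operation $h:A^{(A^n)} \rightarrow A$ of arity $A^n$ in $G$, where $\pi_i:A^n \rightarrow A$ denotes the projection $(i \in n)$.
   Context: A finitary operation on a set $A$ is a map $A^n\to A$ with $n$ a finite cardinal ($n=\{0,\dots,n-1\}$; $n=0$ is allowed). A finitary clone on $A$ is a set $F$ of finitary operations on $A$ that contains all projections $\pi_i:A^n\to A$ and is such that for every $f:A^m\to A$ in $F$ and every family $g_j:A^n\to A$ $(j\in m)$ in $F$, the composite $f\circ(g_j)_{j\in m}:A^n\to A$ lies in $F$. Operations $f:A^n\to A$ and $g:A^m\to A$ commute, written $f\perp g$, if for every matrix $a=(a_{ij})\in A^{n\times m}$ one has $g\bigl((f((a_{ij})_{i\in n}))_{j\in m}\bigr)=f\bigl((g((a_{ij})_{j\in m}))_{i\in n}\bigr)$. For a set $G$ of finitary operations on $A$, the finitary centralizer $G^{\perp(\aleph_0)}$ is the set of all finitary operations $f$ on $A$ with $f\perp g$ for all $g\in G$. Convention: since $A$ is finite, the finite set $A^n$ is identified with its cardinality. Thus "an operation $h:A^{(A^n)}\to A$ of arity $A^n$ in $G$" means a map $h:A^{(A^n)}\to A$ such that, for a chosen bijection $\phi:k\to A^n$ with $k$ the cardinality of $A^n$, the corresponding operation $A^k\cong A^{(A^n)}\xrightarrow{h}A$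 (reindexing along $\phi$) lies in $G$; since $G$ is a clone, this does not depend on the choice of $\phi$. In $h(f)$, the map $f:A^n\to A$ is regarded as an element of $A^{(A^n)}$. -}

module Defs where

open import Data.Fin.Base using (Fin)
open import Data.Nat.Base using (ℕ)
open import Data.Product.Base using (Σ-syntax; ∃-syntax)
open import Data.Vec.Base using (Vec; lookup; tabulate)
open import Function.Base using (_∘_)
open import Function.Bundles using (_↔_; _⟶ₛ_; _⟨$⟩_; Inverse)
open import Level using (Level; _⊔_; suc)
open import Relation.Binary.PropositionalEquality using (_≡_; _≗_; setoid; _→-setoid_)
open import Relation.Unary using (Pred; _∈_)

private variable
  a ℓ : Level
  A : Set a
  m n : ℕ

Finite : Set a → Set a
Finite A = ∃[ c ] (Fin c ↔ A)

-- Tuples are vectors, so that A^n carries propositional equality without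
-- function extensionality; operations are compared pointwise, by _≗_.
Op : Set a → ℕ → Set a
Op A n = Vec A n → A

π : Fin n → Op A n
π i v = lookup v i

_⊚_ : Op A m → (Fin m → Op A n) → Op A n
(f ⊚ g) v = f (tabulate (λ j → g j v))

OpSet : Set a → (ℓ : Level) → Set (a ⊔ suc ℓ)
OpSet A ℓ = ∀ n → Pred (Op A n) ℓ

record IsClone {A : Set a} (G : OpSet A ℓ) : Set (a ⊔ ℓ) where
  field
    -- Membership depends only on the operation as a map; in the absence of
    -- function extensionality this has to be required.
    resp-≗  : {f g : Op A n} → f ≗ g → f ∈ G n → g ∈ G n
    proj    : (i : Fin n) → π i ∈ G n
    compose : {f : Op A m} {g : Fin m → Op A n} →
              f ∈ G m → (∀ j → g j ∈ G n) → (f ⊚ g) ∈ G n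

_⊥ₒ_ : Op A n → Op A m → Set _
_⊥ₒ_ {A = A} {n = n} {m = m} f g =
  (x : Fin n → Fin m → A) →
  g (tabulate (λ j → f (tabulate (λ i → x i j)))) ≡
  f (tabulate (λ i → g (tabulate (λ j → x i j))))

Centralizer : {A : Set a} → OpSet A ℓ → OpSet A (a ⊔ ℓ)
Centralizer {A = A} G n f = ∀ {m} (g : Op A m) → g ∈ G m → f ⊥ₒ g

-- Maps A^(A^n) → A.  Elements of A^(A^n) are functions Vec A n → A taken up to
-- pointwise equality, so such a map is required to respect that equality.
PowerOp : Set a → ℕ → Set a
PowerOp A n = (Vec A n →-setoid A) ⟶ₛ setoid A

-- The operation A^k ≅ A^(A^n) → A obtained from h by reindexing along φ.
reindex : ∀ {k} → Fin k ↔ Vec A n → PowerOp A n → Op A k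
reindex φ h v = h ⟨$⟩ (lookup v ∘ Inverse.from φ)

-- "h is an operation of arity A^n in G".  The bijection is quantified
-- existentially; for a clone G on a finite set its choice is immaterial.
_∈ₚ_ : {A : Set a} → PowerOp A n → OpSet A ℓ → Set (a ⊔ ℓ)
_∈ₚ_ {n = n} {A = A} h G = ∃[ k ] Σ[ φ ∈ Fin k ↔ Vec A n ] reindex φ h ∈ G k

{-# OPTIONS --safe #-}
module Submission where

open import Defs
open import Data.Fin.Base using (Fin; zero)
open import Data.Fin.Properties using (*↔×)
open import Data.Nat.Base using (ℕ; zero; suc; _^_)
open import Data.Product.Base using (_×_; _,_; uncurry)
open import Data.Product.Function.NonDependent.Propositional using (_×-↔_)
open import Data.Vec.Base using (Vec; []; _∷_; lookup; tabulate; uncons)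
open import Data.Vec.Properties using (tabulate-cong; tabulate∘lookup; lookup∘tabulate)
open import Function.Base using (_∘_)
open import Function.Bundles using (_⇔_; _⟨$⟩_; _↔_; Func; Inverse; mk↔ₛ′; mk⇔)
open import Function.Properties.Inverse using (↔-trans)
open import Level using (Level)
open import Relation.Binary.PropositionalEquality using (_≡_; refl; trans; cong; module ≡-Reasoning)
open import Relation.Unary using (_∈_)

-- The matrix whose columns are all the elements of A^n is generic: commuting
-- with h on it is the condition h(f) = f((h(π_i))_i).  Conversely the columns of
-- any n × m matrix form a map c : m → A^n, and commuting of f with g on that
-- matrix is the condition for h = g ∘ A^c, which lies in the clone because it is
-- obtained from g by substituting projections.

private variable
  a ℓ : Level
  A : Set a
  m n : ℕ

×↔Vec : (A × Vec A n) ↔ Vec A (suc n)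
×↔Vec = mk↔ₛ′ (uncurry _∷_) uncons (λ { (_ ∷ _) → refl }) (λ _ → refl)

-- Finiteness of A enters here: A^n gets an enumeration, so that maps A^(A^n) → A can be read as
-- finitary operations.
Fin^↔Vec : ∀ {c} → Fin c ↔ A → ∀ n → Fin (c ^ n) ↔ Vec A n
Fin^↔Vec e zero    = mk↔ₛ′ (λ _ → []) (λ _ → zero) (λ { [] → refl }) (λ { zero → refl })
Fin^↔Vec e (suc n) = ↔-trans *↔× (↔-trans (e ×-↔ Fin^↔Vec e n) ×↔Vec)

Preserves : Op A n → PowerOp A n → Set _
Preserves f h = h ⟨$⟩ f ≡ f (tabulate (λ i → h ⟨$⟩ π i))

-- Listing the values of `p` along `φ` and reading them back through its inverse gives `p` only
-- pointwise, so the step rests on `h` respecting pointwise equality.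
reindex-tabulate : ∀ {k} (φ : Fin k ↔ Vec A n) (h : PowerOp A n) (p : Op A n) →
  reindex φ h (tabulate (p ∘ Inverse.to φ)) ≡ h ⟨$⟩ p
reindex-tabulate φ h p = Func.cong h λ v →
  trans (lookup∘tabulate (p ∘ to) (from v)) (cong p (strictlyInverseˡ v))
  where open Inverse φ

⊥ₒ⇒Preserves : ∀ {k} (φ : Fin k ↔ Vec A n) (h : PowerOp A n) (f : Op A n) →
  f ⊥ₒ reindex φ h → Preserves f h
⊥ₒ⇒Preserves φ h f f⊥h = begin
  h ⟨$⟩ f
    ≡⟨ reindex-tabulate φ h f ⟨
  g (tabulate (f ∘ to))
    ≡⟨ cong g (tabulate-cong λ j → cong f (tabulate∘lookup (to j))) ⟨
  g (tabulate λ j → f (tabulate λ i → lookup (to j) i))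
    -- Column `j` of this matrix is the tuple `to j`, so row `i` lists the values of `π i` on all of
    -- A^n.
    ≡⟨ f⊥h (λ i j → lookup (to j) i) ⟩
  f (tabulate λ i → g (tabulate λ j → lookup (to j) i))
    ≡⟨ cong f (tabulate-cong λ i → reindex-tabulate φ h (π i)) ⟩
  f (tabulate λ i → h ⟨$⟩ π i) ∎
  where
  open ≡-Reasoning
  open Inverse φ
  g = reindex φ h

evalColumns : Op A m → (Fin n → Fin m → A) → PowerOp A n
evalColumns g x = record
  { to   = λ p → g (tabulate λ j → p (tabulate λ i → x i j))
  ; cong = λ p≗q → cong g (tabulate-cong λ j → p≗q _)
  }

evalColumns∈ₚ : Finite A → {G : OpSet A ℓ} → IsClone G →
  {g : Op A m} → g ∈ G m → (x : Fin n → Fin m → A) → evalColumns g x ∈ₚ G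
evalColumns∈ₚ {n = n} (_ , e) isClone g∈G x =
  -- The `j`-th projection reads the coordinate that `φ` assigns to column `j` of `x`; the composite
  -- is then the reindexed operation by definition.
  _ , φ , compose g∈G (λ j → proj (Inverse.from φ (tabulate λ i → x i j)))
  where
  open IsClone isClone
  φ = Fin^↔Vec e n

Preserves⇒⊥ₒ : (f : Op A n) (g : Op A m) →
  (∀ x → Preserves f (evalColumns g x)) → f ⊥ₒ g
-- The left sides agree by definition; on the right, `π i` evaluated at column `j` is the entry
-- `x i j`.
Preserves⇒⊥ₒ f g pres x = trans (pres x)
  (cong f (tabulate-cong λ i → cong g (tabulate-cong λ j →
    lookup∘tabulate (λ i → x i j) i)))

corollary5p8 : ∀ {a ℓ : Level} {A : Set a} → Finite A →
    (G : OpSet A ℓ) → IsClone G →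
    ∀ (n : ℕ) (f : Op A n) →
    (f ∈ Centralizer G n) ⇔
    (∀ (h : PowerOp A n) → h ∈ₚ G →
    h ⟨$⟩ f ≡ f (tabulate (λ i → h ⟨$⟩ π i)))
corollary5p8 {A = A} finite G isClone n f = mk⇔ only-if if
  where
  only-if : f ∈ Centralizer G n → (h : PowerOp A n) → h ∈ₚ G → Preserves f h
  only-if f∈G⊥ h (_ , φ , h∈G) = ⊥ₒ⇒Preserves φ h f (f∈G⊥ (reindex φ h) h∈G)

  if : ((h : PowerOp A n) → h ∈ₚ G → Preserves f h) → f ∈ Centralizer G n
  if pres g g∈G = Preserves⇒⊥ₒ f g λ x →
    pres (evalColumns g x) (evalColumns∈ₚ finite isClone g∈G x)
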